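{- Let $G=(V,E_1,\dots,E_k)$ be a complete edge-colored graph. Then the following statements are equivalent: (i) $G$ is a complete edge-colored permutation graph, i.e., there exists a labeling $\ell$ of $G$ such that for each monochromatic subgraph $G_{|i}$ of $G$, $(G_{|i},\ell)$ is a simple permutation graph. (ii) Each induced subgraph of $G$ is a complete edge-colored permutation graph. (iii) For each strong module $M$ of $G$, the quotient graph $G[M]/\mathbb{P}_{\max}(M)$ is a complete edge-colored permutation graph. (iv) For each strong prime module $M$ of $G$, the quotient graph $G[M]/\mathbb{P}_{\max}(M)$ is a complete edge-colored permutation graph; in particular, the quotient graph of each strong prime module on at least three vertices is $2$-edge-colored. (v) Each monochromatic subgraph $G_{|i}$ of $G$, together with some labeling (possibly depending on $i$ and different from the one in (i)), is a simple permutation graph, and $G$ does not contain a rainbow triangle.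
   Context: All graphs are finite, simple and undirected; $[n]=\{1,\dots,n\}$. A permutation of length $n$ is a bijection $\pi:[n]\to[n]$. A labeling of a graph with vertex set $V$ is a bijection $\ell:V\to[|V|]$. A graph $H=(V,E)$ together with a labeling $\ell$ is a (simple) permutation graph of a permutation $\pi$ of length $|V|$ if for all $u,v\in V$ with $\ell(u)>\ell(v)$: $\{u,v\}\in E$ iff $\pi^{ -1}(\ell(u))<\pi^{ -1}(\ell(v))$; $H$ is a simple permutation graph if such $\ell,\pi$ exist. A complete $k$-edge-colored graph $G=(V,E_1,\dots,E_k)$ is the complete graph on $V$ whose edge set is partitioned into $k$ nonempty color classes $E_1,\dots,E_k$ (edge $e\in E_i$ has color $i$); the one-vertex graph is also regarded as a complete edge-colored graph. The $i$-th monochromatic subgraph is $G_{|i}=(V,E_i)$. Induced subgraphs keep the colors of their edges (and may use fewer colors). $G$ is a complete edge-colored permutation graph if there are a labeling $\ell$ and permutations $\pi_1,\dots,\pi_k$ such that $(G_{|i},\ell)$ is a simple permutation graph of $\pi_i$ for each $i$. A rainbow triangle is a set of three vertices whose three edges have pairwise distinct colors. A module of $G$ is a set $M\subseteq V$ such that for every $v\in V\setminus M$ all edges $\{u,v\}$ with $u\in M$ have the same color. A strong module is a nonempty module $M$ such that every module $M'$ satisfies $M\subseteq M'$, $M'\subseteq M$ or $M\cap M'=\emptyset$. For a strong module $M$ with $|M|\ge 2$, $\mathbb{P}_{\max}(M)$ is the set of inclusion-maximal strong modules properly contained in $M$ (it partitions $M$); the quotient graph $G[M]/\mathbb{P}_{\max}(M)$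 is the complete graph on vertex set $\mathbb{P}_{\max}(M)$ in which the edge $\{M_a,M_b\}$ gets the (common) color of all edges $\{u,v\}$ with $u\in M_a$, $v\in M_b$. For $|M|=1$ the quotient graph is the one-vertex graph. A strong module $M$ is series if its quotient graph has at least two vertices and all its edges have the same color, and prime otherwise. -}

module Defs where

open import Data.Nat using (ℕ; _≤_; s≤s)
open import Data.Fin using (Fin; _<_)
open import Data.Fin.Properties using (_≟_)
open import Data.Fin.Permutation using (Permutation′; _⟨$⟩ˡ_)
open import Data.Fin.Subset using (Subset; _∈_; _∉_; _⊆_; _⊂_; _∩_; Nonempty; Empty; ∣_∣)
open import Data.Fin.Subset.Properties using (nonempty?; Empty-unique; ∣⊥∣≡0; x∈p∩q⁺; ⊆-antisym)
open import Data.Empty using (⊥-elim-irr)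
open import Data.Irrelevant using ([_])
open import Data.Product using (Σ-syntax; ∃-syntax; _×_; _,_; proj₁; proj₂)
open import Data.Refinement using (Refinement; value; value-injective; _,_)
open import Data.Sum using (_⊎_; inj₁; inj₂)
open import Function using (_∘_)
open import Function.Bundles using (_↔_; _⇔_; Inverse)
open import Relation.Binary.PropositionalEquality
  using (_≡_; _≢_; refl; sym; trans; cong; subst; ≢-sym)
open import Relation.Nullary using (¬_; yes; no; contradiction; recompute)

private
  variable
    k m n : ℕ
    V : Set

record SimpleGraph (V : Set) : Set₁ where
  field
    Adj    : V → V → Set
    symm   : ∀ {u v} → Adj u v → Adj v u
    irrefl : ∀ {v} → ¬ Adj v v

-- A complete graph on V with edges coloured from the palette Fin k.  A colour
-- may be absent, so that induced subgraphs and quotients keep the palette of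
-- the graph they come from.  The argument u ≢ v keeps loops uncoloured (and
-- allows k = 0 on one vertex); it is irrelevant, so colours do not depend on it.
record EdgeColoredGraph (k : ℕ) (V : Set) : Set where
  field
    color     : (u v : V) → .(u ≢ v) → Fin k
    color-sym : ∀ u v .(u≢v : u ≢ v) → color u v u≢v ≡ color v u (≢-sym u≢v)

open EdgeColoredGraph public

Occurs : EdgeColoredGraph k V → Fin k → Set
Occurs {V = V} G i = ∃[ u ] ∃[ v ] Σ[ u≢v ∈ u ≢ v ] color G u v u≢v ≡ i

-- Every colour class is nonempty, except that the one-vertex graph is
-- admitted although it has no edges.
IsCompleteEdgeColored : EdgeColoredGraph k (Fin n) → Set
IsCompleteEdgeColored {n = n} G = (∀ i → Occurs G i) ⊎ n ≡ 1

monochromatic : EdgeColoredGraph k V → Fin k → SimpleGraph V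
monochromatic G i = record
  { Adj    = λ u v → Σ[ u≢v ∈ u ≢ v ] color G u v u≢v ≡ i
  ; symm   = λ { {u} {v} (u≢v , eq) → ≢-sym u≢v , trans (sym (color-sym G u v u≢v)) eq }
  ; irrefl = λ (v≢v , _) → contradiction refl v≢v
  }

------------------------------------------------------------------------
-- Permutation graphs

-- Labels are taken in Fin m, i.e. {0,…,m-1} instead of {1,…,m}; a bijection
-- V ↔ Fin m forces m = |V|.  _⟨$⟩ˡ_ applies the inverse of a permutation.
IsPermutationGraphOf : SimpleGraph V → V ↔ Fin m → Permutation′ m → Set
IsPermutationGraphOf H ℓ π =
  ∀ u v → to v < to u → Adj u v ⇔ (π ⟨$⟩ˡ to u) < (π ⟨$⟩ˡ to v)
  where
  open SimpleGraph H
  open Inverse ℓ using (to)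

IsPermutationGraph : SimpleGraph V → Set
IsPermutationGraph {V} H =
  ∃[ m ] Σ[ ℓ ∈ V ↔ Fin m ] Σ[ π ∈ Permutation′ m ] IsPermutationGraphOf H ℓ π

-- Colours of the palette that do not occur impose no condition: their class
-- is edgeless, hence a permutation graph of the identity for every labeling.
IsEdgeColoredPermutationGraph : EdgeColoredGraph k V → Set
IsEdgeColoredPermutationGraph {k} {V} G =
  ∃[ m ] Σ[ ℓ ∈ V ↔ Fin m ] Σ[ π ∈ (Fin k → Permutation′ m) ]
    (∀ i → IsPermutationGraphOf (monochromatic G i) ℓ (π i))

------------------------------------------------------------------------
-- Induced subgraphs, rainbow triangles, number of colours

induced : EdgeColoredGraph k (Fin n) → (W : Subset n) →
          EdgeColoredGraph k (Refinement (Fin n) (_∈ W))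
induced G W = record
  { color     = λ u v u≢v → color G (value u) (value v) (λ eq → u≢v (value-injective eq))
  ; color-sym = λ u v u≢v → color-sym G (value u) (value v) (λ eq → u≢v (value-injective eq))
  }

HasRainbowTriangle : EdgeColoredGraph k V → Set
HasRainbowTriangle G =
  ∃[ u ] ∃[ v ] ∃[ w ]
    Σ[ u≢v ∈ u ≢ v ] Σ[ v≢w ∈ v ≢ w ] Σ[ u≢w ∈ u ≢ w ]
      color G u v u≢v ≢ color G v w v≢w ×
      color G v w v≢w ≢ color G u w u≢w ×
      color G u v u≢v ≢ color G u w u≢w

-- Exactly two colours occur.
Is2EdgeColored : EdgeColoredGraph k V → Set
Is2EdgeColored G =
  ∃[ i ] ∃[ j ] i ≢ j × Occurs G i × Occurs G j ×
    (∀ u v (u≢v : u ≢ v) → color G u v u≢v ≡ i ⊎ color G u v u≢v ≡ j)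

------------------------------------------------------------------------
-- Modules and quotients

module _ (G : EdgeColoredGraph k (Fin n)) where

  -- For u ∈ M and v ∉ M the hypothesis u ≢ v always holds; it is quantified
  -- over only to speak about the edge {u,v}.
  IsModule : Subset n → Set
  IsModule M = ∀ v → v ∉ M → ∀ u u′ → u ∈ M → u′ ∈ M →
    (u≢v : u ≢ v) (u′≢v : u′ ≢ v) → color G u v u≢v ≡ color G u′ v u′≢v

  IsStrongModule : Subset n → Set
  IsStrongModule M = Nonempty M × IsModule M ×
    (∀ M′ → IsModule M′ → M ⊆ M′ ⊎ M′ ⊆ M ⊎ Empty (M ∩ M′))

  IsMaxStrongIn : Subset n → Subset n → Set
  IsMaxStrongIn M N = IsStrongModule N × N ⊂ M ×
    (∀ N′ → IsStrongModule N′ → N′ ⊂ M → N ⊆ N′ → N′ ⊆ N)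

  -- The vertices of G[M]/ℙmax(M).  A singleton M has no strong module properly
  -- inside it; its quotient is the one-vertex graph, with vertex M.
  IsQuotientVertex : Subset n → Subset n → Set
  IsQuotientVertex M N = (2 ≤ ∣ M ∣ × IsMaxStrongIn M N) ⊎ (∣ M ∣ ≡ 1 × N ≡ M)

  QuotientVertex : Subset n → Set
  QuotientVertex M = Refinement (Subset n) (IsQuotientVertex M)

  private
    variable
      M N N′ : Subset n

  IsQuotientVertex⇒Nonempty : IsQuotientVertex M N → Nonempty N
  IsQuotientVertex⇒Nonempty (inj₁ (_ , (ne , _) , _)) = ne
  IsQuotientVertex⇒Nonempty {M} (inj₂ (∣M∣≡1 , refl)) with nonempty? M
  ... | yes ne = ne
  ... | no ¬ne = contradiction
    (trans (sym ∣M∣≡1) (trans (cong ∣_∣ (Empty-unique ¬ne)) (∣⊥∣≡0 n))) λ ()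

  IsQuotientVertex-disjoint : ∀ {x} → IsQuotientVertex M N → IsQuotientVertex M N′ →
                              x ∈ N → x ∈ N′ → N ≡ N′
  IsQuotientVertex-disjoint (inj₁ (_ , sN@(_ , _ , tri) , N⊂M , maxN))
                            (inj₁ (_ , sN′@(_ , mN′ , _) , N′⊂M , maxN′)) x∈N x∈N′
    with tri _ mN′
  ... | inj₁ N⊆N′          = ⊆-antisym N⊆N′ (maxN _ sN′ N′⊂M N⊆N′)
  ... | inj₂ (inj₁ N′⊆N)   = ⊆-antisym (maxN′ _ sN N⊂M N′⊆N) N′⊆N
  ... | inj₂ (inj₂ empty)  = contradiction (_ , x∈p∩q⁺ (x∈N , x∈N′)) empty
  IsQuotientVertex-disjoint (inj₂ (_ , N≡M)) (inj₂ (_ , N′≡M)) _ _ = trans N≡M (sym N′≡M)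
  IsQuotientVertex-disjoint (inj₁ (2≤∣M∣ , _)) (inj₂ (∣M∣≡1 , _)) _ _ =
    contradiction (subst (2 ≤_) ∣M∣≡1 2≤∣M∣) λ { (s≤s ()) }
  IsQuotientVertex-disjoint (inj₂ (∣M∣≡1 , _)) (inj₁ (2≤∣M∣ , _)) _ _ =
    contradiction (subst (2 ≤_) ∣M∣≡1 2≤∣M∣) λ { (s≤s ()) }

  elementOf : (A : QuotientVertex M) → Nonempty (value A)
  elementOf (N , [ p ]) = recompute (nonempty? N) (IsQuotientVertex⇒Nonempty p)

  representative : QuotientVertex M → Fin n
  representative A = proj₁ (elementOf A)

  representative-injective : (A B : QuotientVertex M) →
                             .(A ≢ B) → representative A ≢ representative B
  representative-injective A@(_ , [ p ]) B@(_ , [ q ]) A≢B eq = ⊥-elim-irr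
    (A≢B (value-injective (IsQuotientVertex-disjoint p q
      (proj₂ (elementOf A)) (subst (_∈ value B) (sym eq) (proj₂ (elementOf B))))))

  -- The colour of {A,B} is read off at representatives; by quotient-color
  -- below it is the common colour of all edges between A and B.
  quotient : (M : Subset n) → EdgeColoredGraph k (QuotientVertex M)
  quotient M = record
    { color     = λ A B A≢B → color G (representative A) (representative B)
                                (representative-injective A B A≢B)
    ; color-sym = λ A B A≢B → color-sym G (representative A) (representative B)
                                (representative-injective A B A≢B)
    }

  quotient-color : (A B : QuotientVertex M) (A≢B : A ≢ B) →
                   ∀ {u v} → u ∈ value A → v ∈ value B → (u≢v : u ≢ v) →
                   color (quotient M) A B A≢B ≡ color G u v u≢v
  quotient-color {M} A@(N , [ p ]) B@(N′ , [ q ]) A≢B {u} {v} u∈A v∈B u≢v =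
    recompute (_ ≟ _) (common p q)
    where
    a = representative A
    b = representative B
    a∈A = proj₂ (elementOf A)
    b∈B = proj₂ (elementOf B)
    a≢b = representative-injective A B A≢B

    common : IsQuotientVertex M N → IsQuotientVertex M N′ → color G a b a≢b ≡ color G u v u≢v
    common (inj₂ (_ , N≡M)) (inj₂ (_ , N′≡M)) =
      contradiction (value-injective (trans N≡M (sym N′≡M))) A≢B
    common (inj₁ (2≤∣M∣ , _)) (inj₂ (∣M∣≡1 , _)) =
      contradiction (subst (2 ≤_) ∣M∣≡1 2≤∣M∣) λ { (s≤s ()) }
    common (inj₂ (∣M∣≡1 , _)) (inj₁ (2≤∣M∣ , _)) =
      contradiction (subst (2 ≤_) ∣M∣≡1 2≤∣M∣) λ { (s≤s ()) }
    common p@(inj₁ (_ , (_ , mA , _) , _)) q@(inj₁ (_ , (_ , mB , _) , _)) =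
      trans (mA b (λ b∈A → disjoint b∈A b∈B) a u a∈A u∈A a≢b u≢b)
        (trans (color-sym G u b u≢b)
          (trans (mB u (disjoint u∈A) b v b∈B v∈B (≢-sym u≢b) (≢-sym u≢v))
            (sym (color-sym G u v u≢v))))
      where
      disjoint : ∀ {x} → x ∈ N → x ∉ N′
      disjoint x∈A x∈B = A≢B (value-injective (IsQuotientVertex-disjoint p q x∈A x∈B))
      u≢b : u ≢ b
      u≢b u≡b = disjoint u∈A (subst (_∈ N′) (sym u≡b) b∈B)

  -- Series and prime are used for strong modules only.
  IsSeries : Subset n → Set
  IsSeries M = (Σ[ A ∈ QuotientVertex M ] Σ[ B ∈ QuotientVertex M ] A ≢ B) ×
    (∀ A B C D (A≢B : A ≢ B) (C≢D : C ≢ D) →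
      color (quotient M) A B A≢B ≡ color (quotient M) C D C≢D)

  IsPrime : Subset n → Set
  IsPrime M = ¬ IsSeries M

{-# OPTIONS --safe #-}

-- A labeling makes every colour class a permutation graph iff, in the order of the labels,
-- u < v < w forces the colour of uw to be that of uv or of vw: then, for each colour,
-- reversing the edges of that colour turns the order into another linear order.  Such an order
-- restricts to subsets, excludes rainbow triangles, and can be assembled along the modular
-- decomposition from orders of the quotients.
--
-- Without rainbow triangles, the components of a colour inside a strong module M are strong
-- modules, so each colour occurring in the quotient of M is connected on M.  At most two colours
-- can be connected on a set with two or more vertices (Gallai), hence a prime quotient has two
-- colours, and a permutation graph of one of them orders both.
module Submission where

open import Defs
import Data.Bool as Bool
open import Data.Empty using (⊥-elim)
open import Data.Fin as Fin using (Fin; zero; suc; toℕ; fromℕ<; punchOut)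
open import Data.Fin.Permutation using (Permutation′; _⟨$⟩ˡ_)
open import Data.Fin.Properties as Fin using (_≟_; any?; all?)
open import Data.Fin.Subset
open import Data.Fin.Subset.Induction
open import Data.Fin.Subset.Properties
open import Data.Irrelevant using ([_])
open import Data.Maybe using (Maybe; just; nothing)
import Data.Maybe.Properties as Maybe
open import Data.Maybe.Properties using (just-injective)
open import Data.Nat as ℕ using (ℕ; zero; suc; _+_; _*_; _≤_)
import Data.Nat.Properties as ℕ
open import Data.Product using (Σ-syntax; ∃-syntax; ∃; _×_; _,_; proj₁; proj₂)
open import Data.Refinement using (Refinement; value; value-injective; _,_)
open import Data.Sum using (_⊎_; inj₁; inj₂; [_,_]′)
open import Data.Vec using (tabulate; _∷_; []; here; there)
import Data.Vec.Properties as Vec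
open import Data.Vec.Properties using ([]=⇒lookup; lookup⇒[]=; lookup∘tabulate)
open import Function using (_∘_; id)
open import Function.Bundles using (_↔_; _⇔_; Inverse; mk↔ₛ′; mk⇔; Equivalence)
open import Function.Properties.Inverse using (↔-refl; ↔-sym; ↔-trans)
import Relation.Binary as B
open import Relation.Binary using (tri<; tri≈; tri>)
open import Relation.Binary.PropositionalEquality
open import Relation.Nullary
  using (¬_; Dec; yes; no; does; contradiction; recompute; ¬?; _×-dec_; _⊎-dec_; _→-dec_)
open import Relation.Nullary.Decidable using (decidable-stable; dec-true; map′)
open import Relation.Unary using (Decidable)

private
  variable
    k m n : ℕ
    V Color : Set

-- Finite sets

module _ {P : Fin n → Set} (P? : Decidable P) where

  ⟦_⟧ : Subset n
  ⟦_⟧ = tabulate (does ∘ P?)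

  ∈⟦⟧⁺ : ∀ {x} → P x → x ∈ ⟦_⟧
  ∈⟦⟧⁺ {x} px = lookup⇒[]= x _ (trans (lookup∘tabulate _ x) (dec-true (P? x) px))

  ∈⟦⟧⁻ : ∀ {x} → x ∈ ⟦_⟧ → P x
  ∈⟦⟧⁻ {x} x∈ with P? x | trans (sym (lookup∘tabulate (does ∘ P?) x)) ([]=⇒lookup x∈)
  ... | yes px | _ = px
  ... | no _   | ()

nth : (S : Subset n) → Fin ∣ S ∣ → Fin n
nth (inside  ∷ S) zero    = zero
nth (inside  ∷ S) (suc i) = suc (nth S i)
nth (outside ∷ S) i       = suc (nth S i)

nth-∈ : (S : Subset n) (i : Fin ∣ S ∣) → nth S i ∈ S
nth-∈ (inside  ∷ S) zero    = here
nth-∈ (inside  ∷ S) (suc i) = there (nth-∈ S i)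
nth-∈ (outside ∷ S) i       = there (nth-∈ S i)

nth-injective : (S : Subset n) {i j : Fin ∣ S ∣} → nth S i ≡ nth S j → i ≡ j
nth-injective (inside  ∷ S) {zero}  {zero}  _  = refl
nth-injective (inside  ∷ S) {suc i} {suc j} eq = cong suc (nth-injective S (Fin.suc-injective eq))
nth-injective (outside ∷ S)                 eq = nth-injective S (Fin.suc-injective eq)

index : {S : Subset n} {x : Fin n} → x ∈ S → Fin ∣ S ∣
index {S = inside  ∷ _} here      = zero
index {S = inside  ∷ _} (there p) = suc (index p)
index {S = outside ∷ _} (there p) = index p

nth-index : {S : Subset n} {x : Fin n} (p : x ∈ S) → nth S (index p) ≡ x
nth-index {S = inside  ∷ _} here      = refl
nth-index {S = inside  ∷ _} (there p) = cong suc (nth-index p)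
nth-index {S = outside ∷ _} (there p) = cong suc (nth-index p)

-- Needed to label the vertices of quotients and induced subgraphs: the image of `e` is a decidable
-- subset, which `nth` and `index` enumerate.
embedding⇒finite : (e : V → Fin n) → (∀ {u v} → e u ≡ e v → u ≡ v) →
                   (∀ x → Dec (∃[ v ] e v ≡ x)) → ∃[ m ] (V ↔ Fin m)
embedding⇒finite {V} e inj image? = ∣ S ∣ , mk↔ₛ′ to from
  (λ i → nth-injective S (trans (nth-index _) (e∘from i)))
  (λ v → inj (trans (e∘from (to v)) (nth-index _)))
  where
  S = ⟦ image? ⟧
  to : V → Fin ∣ S ∣
  to v = index (∈⟦⟧⁺ image? (v , refl))
  from : Fin ∣ S ∣ → V
  from i = proj₁ (∈⟦⟧⁻ image? (nth-∈ S i))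
  e∘from : ∀ i → e (from i) ≡ nth S i
  e∘from i = proj₂ (∈⟦⟧⁻ image? (nth-∈ S i))

-- Pigeonhole: if `y` were missed, punching it out would inject the domain into a smaller finite
-- set.
injective⇒surjective : {f : Fin m → Fin m} → (∀ {x y} → f x ≡ f y → x ≡ y) → ∀ y → ∃[ x ] f x ≡ y
injective⇒surjective {suc m} {f} inj y = decidable-stable (any? λ x → f x ≟ y) λ miss →
  contradiction
    (Fin.injective⇒≤ {f = λ x → punchOut (y≢f miss x)}
      (λ {x} {x′} eq → inj (Fin.punchOut-injective (y≢f miss x) (y≢f miss x′) eq)))
    ℕ.1+n≰n
  where
  y≢f : ¬ (∃[ x ] f x ≡ y) → ∀ x → y ≢ f x
  y≢f miss x y≡fx = miss (x , sym y≡fx)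

module _ (ι : V ↔ Fin m) where

  open Inverse ι

  finite-≟ : B.DecidableEquality V
  finite-≟ u v = map′ (λ eq → trans (sym (strictlyInverseʳ u)) (trans (cong from eq) (strictlyInverseʳ v)))
    (cong to) (to u ≟ to v)

  finite-any? : {P : V → Set} → Decidable P → Dec (∃ P)
  finite-any? {P} P? = map′ (λ (x , px) → from x , px)
    (λ (v , pv) → to v , subst P (sym (strictlyInverseʳ v)) pv) (any? (P? ∘ from))

module _ {_≺_ : V → V → Set} (ι : V ↔ Fin m)
         (≺? : B.Decidable _≺_) (≺-trans : B.Transitive _≺_)
         (≺-irrefl : ∀ {u} → ¬ u ≺ u) (≺-total : ∀ u v → u ≢ v → u ≺ v ⊎ v ≺ u) where

  open Inverse ι

  private
    below? : ∀ v → Decidable λ x → from x ≺ v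
    below? v x = ≺? (from x) v

    below : V → Subset m
    below v = ⟦ below? v ⟧

    ∈below⁺ : ∀ {u v} → u ≺ v → to u ∈ below v
    ∈below⁺ {u} {v} u≺v = ∈⟦⟧⁺ (below? v) (subst (_≺ v) (sym (strictlyInverseʳ u)) u≺v)

    ∈below⁻ : ∀ {u v} → to u ∈ below v → u ≺ v
    ∈below⁻ {u} {v} u∈ = subst (_≺ v) (strictlyInverseʳ u) (∈⟦⟧⁻ (below? v) u∈)

    below-strict : ∀ {u v} → u ≺ v → below u ⊂ below v
    below-strict {u} {v} u≺v =
      (λ x∈ → ∈⟦⟧⁺ (below? v) (≺-trans (∈⟦⟧⁻ (below? u) x∈) u≺v)) ,
      to u , ∈below⁺ u≺v , ≺-irrefl ∘ ∈below⁻

    ∣below∣<m : ∀ v → ∣ below v ∣ ℕ.< m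
    ∣below∣<m v = subst (∣ below v ∣ ℕ.<_) (∣⊤∣≡n m)
      (p⊂q⇒∣p∣<∣q∣ {p = below v} (⊆-max _ , to v , ∈⊤ , ≺-irrefl ∘ ∈below⁻))

    rank : V → Fin m
    rank v = fromℕ< (∣below∣<m v)

    rank-mono : ∀ {u v} → u ≺ v → rank u Fin.< rank v
    rank-mono u≺v = subst₂ ℕ._<_ 
      (sym (Fin.toℕ-fromℕ< (∣below∣<m _))) (sym (Fin.toℕ-fromℕ< (∣below∣<m _)))
      (p⊂q⇒∣p∣<∣q∣ (below-strict u≺v))

    rank-injective : ∀ {x y} → rank (from x) ≡ rank (from y) → x ≡ y
    rank-injective {x} {y} eq = decidable-stable (x ≟ y) λ x≢y →
      [ (λ p → ℕ.<⇒≢ (rank-mono p) (cong toℕ eq))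
      , (λ p → ℕ.<⇒≢ (rank-mono p) (cong toℕ (sym eq))) ]′
      (≺-total _ _ λ eq′ → x≢y (trans (sym (strictlyInverseˡ x)) (trans (cong to eq′) (strictlyInverseˡ y))))

  -- Counting the elements below a given one yields strictly increasing ranks; ranking is thus
  -- injective and, on a finite set, bijective.
  sort : Σ[ ρ ∈ V ↔ Fin m ] (∀ {u v} → u ≺ v ⇔ Inverse.to ρ u Fin.< Inverse.to ρ v)
  sort = ↔-trans ι ρ , mk⇔ mono reflect
    where
    surj = injective⇒surjective rank-injective
    ρ : Permutation′ m
    ρ = mk↔ₛ′ (rank ∘ from) (proj₁ ∘ surj) (proj₂ ∘ surj)
          (λ x → rank-injective (proj₂ (surj (rank (from x)))))
    mono : ∀ {u v} → u ≺ v → rank (from (to u)) Fin.< rank (from (to v))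
    mono {u} {v} u≺v = subst₂ (λ u v → rank u Fin.< rank v)
      (sym (strictlyInverseʳ u)) (sym (strictlyInverseʳ v)) (rank-mono u≺v)
    reflect : ∀ {u v} → rank (from (to u)) Fin.< rank (from (to v)) → u ≺ v
    reflect {u} {v} lt with to u ≟ to v
    ... | yes eq = contradiction (cong (toℕ ∘ rank ∘ from) eq) (ℕ.<⇒≢ lt)
    ... | no u≢v with ≺-total u v (u≢v ∘ cong to)
    ...   | inj₁ u≺v = u≺v
    ...   | inj₂ v≺u = contradiction (mono v≺u) (ℕ.<⇒≯ lt)

module _ {P : Subset n → Set} (P? : Decidable P) where

  allSubsets? : Dec (∀ S → P S)
  allSubsets? with anySubset? (¬? ∘ P?)
  ... | yes (S , ¬p) = no λ all → ¬p (all S)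
  ... | no ¬∃¬       = yes λ S → decidable-stable (P? S) λ ¬p → ¬∃¬ (S , ¬p)

  maximal : ∀ {S} → P S → ∃[ N ] S ⊆ N × P N × (∀ N′ → P N′ → N ⊆ N′ → N′ ⊆ N)
  maximal {S} = go S (⊃-wellFounded S)
    where
    go : ∀ S → Acc _⊃_ S → P S → ∃[ N ] S ⊆ N × P N × (∀ N′ → P N′ → N ⊆ N′ → N′ ⊆ N)
    go S (acc rec) pS with anySubset? (λ N → (S ⊂? N) ×-dec P? N)
    ... | yes (N , S⊂N , pN) = let N′ , N⊆N′ , rest = go N (rec S⊂N) pN in
                               N′ , (λ x∈ → N⊆N′ (proj₁ S⊂N x∈)) , rest
    ... | no none = S , (λ x∈ → x∈) , pS , λ N′ pN′ S⊆N′ {x} x∈N′ →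
      decidable-stable (x ∈? S) λ x∉S → none (N′ , (S⊆N′ , x , x∈N′ , x∉S) , pN′)

  minimal : ∀ {S} → P S → ∃[ N ] P N × (∀ N′ → P N′ → N′ ⊆ N → N ⊆ N′)
  minimal {S} = go S (⊂-wellFounded S)
    where
    go : ∀ S → Acc _⊂_ S → P S → ∃[ N ] P N × (∀ N′ → P N′ → N′ ⊆ N → N ⊆ N′)
    go S (acc rec) pS with anySubset? (λ N → (N ⊂? S) ×-dec P? N)
    ... | yes (N , N⊂S , pN) = go N (rec N⊂S) pN
    ... | no none = S , pS , λ N′ pN′ N′⊆S {x} x∈S →
      decidable-stable (x ∈? N′) λ x∉N′ → none (N′ , (N′⊆S , x , x∈S , x∉N′) , pN′)

⊈⇒∃∉ : {S T : Subset n} → ¬ (S ⊆ T) → ∃[ x ] x ∈ S × x ∉ T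
⊈⇒∃∉ {S = S} {T} S⊈T = decidable-stable (any? λ x → (x ∈? S) ×-dec ¬? (x ∈? T)) λ none →
  S⊈T λ {x} x∈S → decidable-stable (x ∈? T) λ x∉T → none (x , x∈S , x∉T)

x∉p-x : (p : Subset n) (x : Fin n) → x ∉ p - x
x∉p-x (s ∷ p) zero    ()
x∉p-x (s ∷ p) (suc x) (there x∈) = x∉p-x p x x∈

-- Supplies the base `K` for the lexicographic positions `a * K + b`.
bounded : (S : Subset n) (g : ∀ {x} → x ∈ S → ℕ) → ∃[ K ] (∀ {x} (x∈S : x ∈ S) → g x∈S ℕ.< K)
bounded []            g = 0 , λ ()
bounded (outside ∷ S) g = let K , g<K = bounded S (g ∘ there) in K , λ { (there p) → g<K p }
bounded (inside  ∷ S) g = let K , g<K = bounded S (g ∘ there) in suc (g here) + K ,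
  λ { here → ℕ.m≤m+n _ K ; (there p) → ℕ.<-≤-trans (g<K p) (ℕ.m≤n+m K _) }

lexicographic-mono : ∀ {K a b c d} → b ℕ.< K → a ℕ.< c → a * K + b ℕ.< c * K + d
lexicographic-mono {K} {a} {b} {c} {d} b<K a<c = begin-strict
  a * K + b  <⟨ ℕ.+-monoʳ-< (a * K) b<K ⟩
  a * K + K  ≡⟨ ℕ.+-comm (a * K) K ⟩
  suc a * K  ≤⟨ ℕ.*-monoˡ-≤ K a<c ⟩
  c * K      ≤⟨ ℕ.m≤m+n (c * K) d ⟩
  c * K + d  ∎
  where open ℕ.≤-Reasoning

lexicographic-< : ∀ {K a b c d} → b ℕ.< K → d ℕ.< K → a * K + b ℕ.< c * K + d →
                  a ℕ.< c ⊎ (a ≡ c × b ℕ.< d)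
lexicographic-< {K} {a} {b} {c} {d} b<K d<K lt with ℕ.<-cmp a c
... | tri< a<c _ _  = inj₁ a<c
... | tri≈ _ refl _ = inj₂ (refl , ℕ.+-cancelˡ-< (a * K) b d lt)
... | tri> _ _ c<a  = contradiction (lexicographic-mono d<K c<a) (ℕ.<⇒≯ lt)

lexicographic-≡ : ∀ {K a b c d} → b ℕ.< K → d ℕ.< K → a * K + b ≡ c * K + d → a ≡ c × b ≡ d
lexicographic-≡ {K} {a} {b} {c} {d} b<K d<K eq with ℕ.<-cmp a c
... | tri< a<c _ _  = contradiction eq (ℕ.<⇒≢ (lexicographic-mono b<K a<c))
... | tri≈ _ refl _ = refl , ℕ.+-cancelˡ-≡ (a * K) b d eq
... | tri> _ _ c<a  = contradiction (sym eq) (ℕ.<⇒≢ (lexicographic-mono d<K c<a))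

-- Layouts

-- A layout orders the vertices V, placed on Fin n by e, by distinct positions.
record Layout (c : Fin n → Fin n → Color) (e : V → Fin n) : Set where
  field
    position  : V → ℕ
    injective : ∀ {u v} → position u ≡ position v → e u ≡ e v
    split     : ∀ {u v w} → position u ℕ.< position v → position v ℕ.< position w →
                c (e u) (e w) ≡ c (e u) (e v) ⊎ c (e u) (e w) ≡ c (e v) (e w)

-- The field `injective` only speaks of images under `e`, so `f` may be any map: it can restrict to
-- a subset or attach membership proofs.
pullback : {U : Set} {c : Fin n → Fin n → Color} {e : V → Fin n} →
           Layout c e → (f : U → V) → Layout c (e ∘ f)
pullback L f = record { position = position ∘ f ; injective = injective ; split = split }
  where open Layout L

module _ {H : SimpleGraph V} {ℓ : V ↔ Fin m} {π : Permutation′ m} (permGraph : IsPermutationGraphOf H ℓ π)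
         {u v w : V} (u<v : Inverse.to ℓ u Fin.< Inverse.to ℓ v) (v<w : Inverse.to ℓ v Fin.< Inverse.to ℓ w) where

  open SimpleGraph H
  open Inverse ℓ using (to)

  private
    u<w : to u Fin.< to w
    u<w = ℕ.<-trans u<v v<w

    wv = permGraph w v v<w
    vu = permGraph v u u<v
    wu = permGraph w u u<w

  -- Adjacent vertices are those whose order is inverted by `π`. If u and w are inverted, then v
  -- comes either before u in the new order, or no earlier than u and hence after w.
  permutationGraph-split : Adj u w → Adj u v ⊎ Adj v w
  permutationGraph-split uw with ℕ.<-≤-connex (toℕ (π ⟨$⟩ˡ to v)) (toℕ (π ⟨$⟩ˡ to u))
  ... | inj₁ lt = inj₁ (symm (Equivalence.from vu lt))
  ... | inj₂ ge = inj₂ (symm (Equivalence.from wv (ℕ.<-≤-trans (Equivalence.to wu (symm uw)) ge)))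

  permutationGraph-trans : Adj u v → Adj v w → Adj u w
  permutationGraph-trans uv vw = symm (Equivalence.from wu
    (ℕ.<-trans (Equivalence.to wv (symm vw)) (Equivalence.to vu (symm uv))))

-- Edge-coloured permutation graphs as layouts

module Hue (G : EdgeColoredGraph k (Fin n)) where

  -- Total on pairs, so that statements about edges need no proof of u ≢ v.
  hue : Fin n → Fin n → Maybe (Fin k)
  hue u v with u ≟ v
  ... | yes _  = nothing
  ... | no u≢v = just (color G u v u≢v)

  _≟ʰ_ : B.DecidableEquality (Maybe (Fin k))
  _≟ʰ_ = Maybe.≡-dec _≟_

  hue-≢ : ∀ {u v} (u≢v : u ≢ v) → hue u v ≡ just (color G u v u≢v)
  hue-≢ {u} {v} u≢v with u ≟ v
  ... | yes u≡v = contradiction u≡v u≢v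
  ... | no _    = refl

  hue-loop : ∀ u → hue u u ≡ nothing
  hue-loop u with u ≟ u
  ... | yes _  = refl
  ... | no u≢u = contradiction refl u≢u

  hue-sym : ∀ u v → hue u v ≡ hue v u
  hue-sym u v with u ≟ v
  ... | yes refl = sym (hue-loop u)
  ... | no u≢v   = trans (cong just (color-sym G u v u≢v)) (sym (hue-≢ (≢-sym u≢v)))

  hue⇒≢ : ∀ {u v i} → hue u v ≡ just i → u ≢ v
  hue⇒≢ {u} eq refl with trans (sym (hue-loop u)) eq
  ... | ()

  color⇒hue : ∀ {u v i} (u≢v : u ≢ v) → color G u v u≢v ≡ i → hue u v ≡ just i
  color⇒hue u≢v eq = trans (hue-≢ u≢v) (cong just eq)

  hue⇒color : ∀ {u v i} (u≢v : u ≢ v) → hue u v ≡ just i → color G u v u≢v ≡ i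
  hue⇒color u≢v eq = just-injective (trans (sym (hue-≢ u≢v)) eq)

  -- H has the vertex set V, embedded by e into G with its colours.
  module _ {V : Set} (H : EdgeColoredGraph k V) (e : V → Fin n)
           (agree : ∀ u v (u≢v : u ≢ v) → hue (e u) (e v) ≡ just (color H u v u≢v)) where

    private
      hueᵉ : V → V → Maybe (Fin k)
      hueᵉ u v = hue (e u) (e v)

    -- The labels serve as positions, and the splitting property is used in the monochromatic graph
    -- of the colour of uw.
    permutationGraph⇒layout : IsEdgeColoredPermutationGraph H → Layout hue e
    permutationGraph⇒layout (m , ℓ , π , permGraph) = record
      { position  = toℕ ∘ to
      ; injective = cong e ∘ to-injective ∘ Fin.toℕ-injective
      ; split     = split
      }
      where
      open Inverse ℓ
      to-injective : ∀ {u v} → to u ≡ to v → u ≡ v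
      to-injective {u} {v} eq = trans (sym (strictlyInverseʳ u)) (trans (cong from eq) (strictlyInverseʳ v))
      split : ∀ {u v w} → to u Fin.< to v → to v Fin.< to w →
              hueᵉ u w ≡ hueᵉ u v ⊎ hueᵉ u w ≡ hueᵉ v w
      split {u} {v} {w} u<v v<w =
        [ (λ (u≢v , eq) → inj₁ (trans (agree u w u≢w) (sym (trans (agree u v u≢v) (cong just eq)))))
        , (λ (v≢w , eq) → inj₂ (trans (agree u w u≢w) (sym (trans (agree v w v≢w) (cong just eq)))))
        ]′ (permutationGraph-split {H = monochromatic H i} {ℓ} {π i} (permGraph i) u<v v<w (u≢w , refl))
        where
        u≢w : u ≢ w
        u≢w u≡w = ℕ.<⇒≢ (ℕ.<-trans u<v v<w) (cong (toℕ ∘ to) u≡w)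
        i = color H u w u≢w

    -- Here `ℓ` ranks the vertices by position and `ρ i` ranks them by the order with colour `i`
    -- reversed. The two rankings disagree on a pair exactly when its edge has colour `i`.
    layout⇒permutationGraph : V ↔ Fin m → Layout hue e → IsEdgeColoredPermutationGraph H
    layout⇒permutationGraph {m} ι L = m , ℓ , π , permGraph
      where
      open Layout L

      position-injective : ∀ {u v} → position u ≡ position v → u ≡ v
      position-injective {u} {v} eq = decidable-stable (finite-≟ ι u v) λ u≢v →
        hue⇒≢ (agree u v u≢v) (injective eq)

      ordered : ∀ u v → u ≢ v → position u ℕ.< position v ⊎ position v ℕ.< position u
      ordered u v u≢v with ℕ.<-cmp (position u) (position v)
      ... | tri< lt _ _ = inj₁ lt
      ... | tri≈ _ eq _ = contradiction (position-injective eq) u≢v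
      ... | tri> _ _ gt = inj₂ gt

      sorted = sort ι (λ u v → position u ℕ.<? position v) ℕ.<-trans (ℕ.<-irrefl refl) ordered
      ℓ = proj₁ sorted

      -- The order of the permutation for colour i: the positions, reversed on the edges of colour i.
      module _ (i : Fin k) where

        _≺_ : V → V → Set
        u ≺ v = position u ℕ.< position v × hueᵉ u v ≢ just i ⊎
                position v ℕ.< position u × hueᵉ u v ≡ just i

        ≺? : B.Decidable _≺_
        ≺? u v = (position u ℕ.<? position v ×-dec ¬? (hueᵉ u v ≟ʰ just i)) ⊎-dec
                 (position v ℕ.<? position u ×-dec (hueᵉ u v ≟ʰ just i))

        ≺-irrefl : ∀ {u} → ¬ u ≺ u
        ≺-irrefl = [ ℕ.<-irrefl refl ∘ proj₁ , ℕ.<-irrefl refl ∘ proj₁ ]′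

        rev : ∀ {u v} → hueᵉ u v ≡ just i → hueᵉ v u ≡ just i
        rev = trans (hue-sym _ _)

        ≺-total : ∀ u v → u ≢ v → u ≺ v ⊎ v ≺ u
        ≺-total u v u≢v with ordered u v u≢v | hueᵉ u v ≟ʰ just i
        ... | inj₁ lt | no ≢i  = inj₁ (inj₁ (lt , ≢i))
        ... | inj₁ lt | yes ≡i = inj₂ (inj₂ (lt , rev ≡i))
        ... | inj₂ gt | no ≢i  = inj₂ (inj₁ (gt , ≢i ∘ rev))
        ... | inj₂ gt | yes ≡i = inj₁ (inj₂ (gt , ≡i))

        ≺-trans : B.Transitive _≺_
        ≺-trans (inj₁ (u<v , uv≢i)) (inj₁ (v<w , vw≢i)) =
          inj₁ (ℕ.<-trans u<v v<w , λ uw≡i →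
            [ (λ eq → uv≢i (trans (sym eq) uw≡i)) , (λ eq → vw≢i (trans (sym eq) uw≡i)) ]′ (split u<v v<w))
        -- When exactly one of uv and vw has colour `i`, u and w may be placed either way round.
        -- Splitting the triple in its actual order decides whether uw has colour `i`.
        ≺-trans {u} {v} {w} (inj₁ (u<v , uv≢i)) (inj₂ (w<v , vw≡i)) with ℕ.<-cmp (position u) (position w)
        ... | tri< u<w _ _ = inj₁ (u<w , λ uw≡i →
            [ (λ eq → uv≢i (trans eq uw≡i)) , (λ eq → uv≢i (trans eq (rev vw≡i))) ]′ (split u<w w<v))
        ... | tri≈ _ u≈w _ = contradiction (trans (cong (λ x → hue x (e v)) (injective u≈w)) (rev vw≡i)) uv≢i
        ... | tri> _ _ w<u = inj₂ (w<u ,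
            [ (λ eq → rev (trans (sym eq) (rev vw≡i))) , (λ eq → contradiction (trans (sym eq) (rev vw≡i)) uv≢i) ]′
            (split w<u u<v))
        ≺-trans {u} {v} {w} (inj₂ (v<u , uv≡i)) (inj₁ (v<w , vw≢i)) with ℕ.<-cmp (position u) (position w)
        ... | tri< u<w _ _ = inj₁ (u<w , λ uw≡i →
            [ (λ eq → vw≢i (trans eq (rev uv≡i))) , (λ eq → vw≢i (trans eq uw≡i)) ]′ (split v<u u<w))
        ... | tri≈ _ u≈w _ = contradiction (trans (cong (hue (e v)) (sym (injective u≈w))) (rev uv≡i)) vw≢i
        ... | tri> _ _ w<u = inj₂ (w<u ,
            [ (λ eq → contradiction (trans (sym eq) (rev uv≡i)) vw≢i) , (λ eq → rev (trans (sym eq) (rev uv≡i))) ]′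
            (split v<w w<u))
        ≺-trans (inj₂ (v<u , uv≡i)) (inj₂ (w<v , vw≡i)) =
          inj₂ (ℕ.<-trans w<v v<u ,
            [ (λ eq → rev (trans eq (rev vw≡i))) , (λ eq → rev (trans eq (rev uv≡i))) ]′ (split w<v v<u))

        sortedᵢ = sort ι ≺? ≺-trans ≺-irrefl ≺-total

      ρ : Fin k → V ↔ Fin m
      ρ i = proj₁ (sortedᵢ i)

      -- `IsPermutationGraphOf` applies the inverse permutation, which here sends the label of a
      -- vertex to its rank under `ρ i`.
      π : Fin k → Permutation′ m
      π i = ↔-trans (↔-sym (ρ i)) ℓ

      permGraph : ∀ i → IsPermutationGraphOf (monochromatic H i) ℓ (π i)
      permGraph i u v ℓv<ℓu = mk⇔
        (λ (u≢v , eq) → subst₂ Fin._<_ (sym (πℓ u)) (sym (πℓ v))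
          (Equivalence.to (proj₂ (sortedᵢ i)) (inj₂ (v<u , trans (agree u v u≢v) (cong just eq)))))
        (λ lt → edge (Equivalence.from (proj₂ (sortedᵢ i)) (subst₂ Fin._<_ (πℓ u) (πℓ v) lt)))
        where
        πℓ : ∀ x → π i ⟨$⟩ˡ Inverse.to ℓ x ≡ Inverse.to (ρ i) x
        πℓ x = cong (Inverse.to (ρ i)) (Inverse.strictlyInverseʳ ℓ x)
        v<u : position v ℕ.< position u
        v<u = Equivalence.from (proj₂ sorted) ℓv<ℓu
        u≢v : u ≢ v
        u≢v u≡v = ℕ.<⇒≢ v<u (cong position (sym u≡v))
        edge : _≺_ i u v → Σ[ u≢v ∈ u ≢ v ] color H u v u≢v ≡ i
        edge (inj₁ (u<v , _)) = contradiction v<u (ℕ.<⇒≯ u<v)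
        edge (inj₂ (_ , eq))  = u≢v , just-injective (trans (sym (agree u v u≢v)) eq)

-- Strong modules and their quotients

module Decomposition (G : EdgeColoredGraph k (Fin n)) where

  open Hue G

  private
    variable
      M N : Subset n

  module⇒hue : ∀ {v u u′} → IsModule G M → v ∉ M → u ∈ M → u′ ∈ M → hue u v ≡ hue u′ v
  module⇒hue {M} {v} {u} {u′} mod v∉M u∈M u′∈M =
    trans (hue-≢ u≢v) (trans (cong just (mod v v∉M u u′ u∈M u′∈M u≢v u′≢v)) (sym (hue-≢ u′≢v)))
    where
    u≢v : u ≢ v
    u≢v refl = v∉M u∈M
    u′≢v : u′ ≢ v
    u′≢v refl = v∉M u′∈M

  hue⇒module : (∀ v → v ∉ M → ∀ u u′ → u ∈ M → u′ ∈ M → hue u v ≡ hue u′ v) → IsModule G M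
  hue⇒module h v v∉M u u′ u∈M u′∈M u≢v u′≢v =
    hue⇒color u≢v (trans (h v v∉M u u′ u∈M u′∈M) (hue-≢ u′≢v))

  module? : Decidable (IsModule G)
  module? M = map′ hue⇒module (λ mod v v∉M u u′ → module⇒hue mod v∉M)
    (all? λ v → ¬? (v ∈? M) →-dec all? λ u → all? λ u′ →
      (u ∈? M) →-dec ((u′ ∈? M) →-dec (hue u v ≟ʰ hue u′ v)))

  strong? : Decidable (IsStrongModule G)
  strong? M = nonempty? M ×-dec (module? M ×-dec allSubsets? λ M′ →
    module? M′ →-dec ((M ⊆? M′) ⊎-dec ((M′ ⊆? M) ⊎-dec ¬? (nonempty? (M ∩ M′)))))

  singleton-strong : ∀ x → IsStrongModule G ⁅ x ⁆
  singleton-strong x = (x , x∈⁅x⁆ x) ,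
    hue⇒module (λ v _ u u′ u∈ u′∈ →
      cong (λ y → hue y v) (trans (x∈⁅y⁆⇒x≡y x u∈) (sym (x∈⁅y⁆⇒x≡y x u′∈)))) ,
    λ M′ _ → compare M′
    where
    compare : ∀ M′ → ⁅ x ⁆ ⊆ M′ ⊎ M′ ⊆ ⁅ x ⁆ ⊎ Empty (⁅ x ⁆ ∩ M′)
    compare M′ with x ∈? M′
    ... | yes x∈M′ = inj₁ λ y∈ → subst (_∈ M′) (sym (x∈⁅y⁆⇒x≡y x y∈)) x∈M′
    ... | no x∉M′  = inj₂ (inj₂ λ (y , y∈) → let y∈x , y∈M′ = x∈p∩q⁻ ⁅ x ⁆ M′ y∈ in
                       x∉M′ (subst (_∈ M′) (x∈⁅y⁆⇒x≡y x y∈x) y∈M′))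

  strong⊂⇒2≤ : IsStrongModule G N → N ⊂ M → 2 ℕ.≤ ∣ M ∣
  strong⊂⇒2≤ {N} {M} ((x , x∈N) , _) N⊂M = begin-strict
    1          ≡⟨ ∣⁅x⁆∣≡1 x ⟨
    ∣ ⁅ x ⁆ ∣  ≤⟨ p⊆q⇒∣p∣≤∣q∣ (λ y∈ → subst (_∈ N) (sym (x∈⁅y⁆⇒x≡y x y∈)) x∈N) ⟩
    ∣ N ∣      <⟨ p⊂q⇒∣p∣<∣q∣ N⊂M ⟩
    ∣ M ∣      ∎
    where open ℕ.≤-Reasoning

  part-over : IsStrongModule G N → N ⊂ M → Σ[ A ∈ QuotientVertex G M ] N ⊆ value A
  part-over {N} {M} sN N⊂M =
    let A , N⊆A , (sA , A⊂M) , maxA = maximal (λ N → strong? N ×-dec (N ⊂? M)) (sN , N⊂M)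
    in (A , [ inj₁ (strong⊂⇒2≤ sN N⊂M , sA , A⊂M , λ N′ sN′ N′⊂M → maxA N′ (sN′ , N′⊂M)) ]) , N⊆A

  ⊈singleton⇒⊂ : ∀ {x} → x ∈ M → ¬ (M ⊆ ⁅ x ⁆) → ⁅ x ⁆ ⊂ M
  ⊈singleton⇒⊂ {M} {x} x∈M M⊈x = (λ y∈ → subst (_∈ M) (sym (x∈⁅y⁆⇒x≡y x y∈)) x∈M) , ⊈⇒∃∉ M⊈x

  -- The parts cover `M`: if `M` has another vertex, the singleton of `x` is a strong module
  -- properly inside `M` and extends to a maximal one; otherwise `M` is its own part.
  part-of : ∀ {x} → x ∈ M → Σ[ A ∈ QuotientVertex G M ] x ∈ value A
  part-of {M} {x} x∈M with M ⊆? ⁅ x ⁆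
  ... | yes M⊆x = (M , [ inj₂ (∣M∣≡1 , refl) ]) , x∈M
    where
    ∣M∣≡1 : ∣ M ∣ ≡ 1
    ∣M∣≡1 = trans (cong ∣_∣ (⊆-antisym M⊆x (λ y∈ → subst (_∈ M) (sym (x∈⁅y⁆⇒x≡y x y∈)) x∈M))) (∣⁅x⁆∣≡1 x)
  ... | no M⊈x =
    let A , x⊆A = part-over (singleton-strong x) (⊈singleton⇒⊂ x∈M M⊈x) in A , x⊆A (x∈⁅x⁆ x)

  -- The defining proof of a part is irrelevant, so what follows from it is recovered through
  -- `recompute`, by decidability.
  part-⊆ : (A : QuotientVertex G M) → value A ⊆ M
  part-⊆ {M} (N , [ p ]) {x} x∈N = recompute (x ∈? M) (sub p x∈N)
    where
    sub : IsQuotientVertex G M N → x ∈ N → x ∈ M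
    sub (inj₁ (_ , _ , N⊂M , _)) x∈N = proj₁ N⊂M x∈N
    sub (inj₂ (_ , refl))        x∈N = x∈N

  part-strong : IsStrongModule G M → (A : QuotientVertex G M) → IsStrongModule G (value A)
  part-strong {M} sM (N , [ p ]) = recompute (strong? N) (strong p)
    where
    strong : IsQuotientVertex G M N → IsStrongModule G N
    strong (inj₁ (_ , sN , _)) = sN
    strong (inj₂ (_ , refl))   = sM

  part-⊂ : 2 ℕ.≤ ∣ M ∣ → (A : QuotientVertex G M) → value A ⊂ M
  part-⊂ {M} 2≤∣M∣ (N , [ p ]) = recompute (N ⊂? M) (proper p)
    where
    proper : IsQuotientVertex G M N → N ⊂ M
    proper (inj₁ (_ , _ , N⊂M , _)) = N⊂M
    proper (inj₂ (∣M∣≡1 , _))       = contradiction (subst (2 ℕ.≤_) ∣M∣≡1 2≤∣M∣) ℕ.1+n≰n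

  same-part : ∀ {x} (A B : QuotientVertex G M) → x ∈ value A → x ∈ value B → A ≡ B
  same-part (N , [ p ]) (N′ , [ q ]) x∈N x∈N′ = value-injective
    (recompute (Vec.≡-dec Bool._≟_ N N′) (IsQuotientVertex-disjoint G p q x∈N x∈N′))

  rep : QuotientVertex G M → Fin n
  rep = representative G

  rep-∈ : (A : QuotientVertex G M) → rep A ∈ value A
  rep-∈ A = proj₂ (elementOf G A)

  rep-injective : {A B : QuotientVertex G M} → rep A ≡ rep B → A ≡ B
  rep-injective {A = A} {B} eq = same-part A B (rep-∈ A) (subst (_∈ value B) (sym eq) (rep-∈ B))

  rep-hue : ∀ {u v} (A B : QuotientVertex G M) → A ≢ B → u ∈ value A → v ∈ value B →
            hue (rep A) (rep B) ≡ hue u v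
  rep-hue {u = u} {v} A B A≢B u∈A v∈B =
    trans (hue-≢ (representative-injective G A B A≢B))
      (trans (cong just (quotient-color G A B A≢B u∈A v∈B u≢v)) (sym (hue-≢ u≢v)))
    where
    u≢v : u ≢ v
    u≢v refl = A≢B (same-part A B u∈A v∈B)

  quotient-agree : (A B : QuotientVertex G M) (A≢B : A ≢ B) →
                   hue (rep A) (rep B) ≡ just (color (quotient G M) A B A≢B)
  quotient-agree A B A≢B = hue-≢ (representative-injective G A B A≢B)

  quotient-finite : (M : Subset n) → ∃[ m ] (QuotientVertex G M ↔ Fin m)
  quotient-finite M = embedding⇒finite rep rep-injective image?
    where
    image? : ∀ x → Dec (Σ[ A ∈ QuotientVertex G M ] rep A ≡ x)
    image? x with x ∈? M
    ... | no x∉M  = no λ (A , eq) → x∉M (subst (_∈ M) eq (part-⊆ A (rep-∈ A)))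
    ... | yes x∈M = map′ (A ,_)
      (λ (B , eq) → trans (cong rep (same-part A B x∈A (subst (_∈ value B) eq (rep-∈ B)))) eq) (rep A ≟ x)
      where
      A = proj₁ (part-of x∈M)
      x∈A = proj₂ (part-of x∈M)

  Members : Subset n → Set
  Members M = ∃[ x ] x ∈ M

  -- Lexicographic: first by the position of the part in the quotient, then within the part.
  module _ {M : Subset n} (Q : Layout hue (rep {M}))
           (L : (A : QuotientVertex G M) → Layout hue (proj₁ {B = _∈ value A})) where

    private
      module Q = Layout Q
      module L A = Layout (L A)

      part : Members M → QuotientVertex G M
      part (_ , u∈M) = proj₁ (part-of u∈M)

      part-∋ : (u : Members M) → proj₁ u ∈ value (part u)
      part-∋ (_ , u∈M) = proj₂ (part-of u∈M)

      inner : Members M → ℕ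
      inner u = L.position (part u) (proj₁ u , part-∋ u)

      K : ℕ
      K = proj₁ (bounded M λ x∈M → inner (_ , x∈M))

      inner<K : ∀ u → inner u ℕ.< K
      inner<K (_ , u∈M) = proj₂ (bounded M λ x∈M → inner (_ , x∈M)) u∈M

      position : Members M → ℕ
      position u = Q.position (part u) * K + inner u

      -- Inner positions depend on the part. Stating the equality of parts as a hypothesis between
      -- variables lets it be matched with `refl`.
      inner-injective : ∀ {A B : QuotientVertex G M} → A ≡ B → ∀ {u v} (u∈A : u ∈ value A) (v∈B : v ∈ value B) →
                        L.position A (u , u∈A) ≡ L.position B (v , v∈B) → u ≡ v
      inner-injective {A} refl _ _ = L.injective A

      inner-split : ∀ {A B C : QuotientVertex G M} → A ≡ B → B ≡ C →
                    ∀ {u v w} (u∈A : u ∈ value A) (v∈B : v ∈ value B) (w∈C : w ∈ value C) →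
                    L.position A (u , u∈A) ℕ.< L.position B (v , v∈B) →
                    L.position B (v , v∈B) ℕ.< L.position C (w , w∈C) →
                    hue u w ≡ hue u v ⊎ hue u w ≡ hue v w
      inner-split {A} refl refl _ _ _ = L.split A

      hue-parts : ∀ u v → Q.position (part u) ℕ.< Q.position (part v) →
                  hue (rep (part u)) (rep (part v)) ≡ hue (proj₁ u) (proj₁ v)
      hue-parts u v lt = rep-hue (part u) (part v) (λ eq → ℕ.<⇒≢ lt (cong Q.position eq)) (part-∋ u) (part-∋ v)

      same : ∀ {u v} → Q.position (part u) ≡ Q.position (part v) → part u ≡ part v
      same = rep-injective ∘ Q.injective

      -- Three different parts are split by `Q`, and three vertices of one part by its inner layout.
      -- If only two neighbours in the order share a part, their edges to the third vertex run
      -- between the same two parts and agree in colour.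
      split : ∀ {u v w} → position u ℕ.< position v → position v ℕ.< position w →
              hue (proj₁ u) (proj₁ w) ≡ hue (proj₁ u) (proj₁ v) ⊎ hue (proj₁ u) (proj₁ w) ≡ hue (proj₁ v) (proj₁ w)
      split {u} {v} {w} u<v v<w
        with lexicographic-< (inner<K u) (inner<K v) u<v | lexicographic-< (inner<K v) (inner<K w) v<w
      ... | inj₁ A<B | inj₁ B<C =
        [ (λ eq → inj₁ (trans (sym uw) (trans eq (hue-parts u v A<B))))
        , (λ eq → inj₂ (trans (sym uw) (trans eq (hue-parts v w B<C)))) ]′ (Q.split A<B B<C)
        where uw = hue-parts u w (ℕ.<-trans A<B B<C)
      ... | inj₁ A<B | inj₂ (B≡C , _) = inj₁ (trans
        (sym (hue-parts u w (subst (Q.position (part u) ℕ.<_) B≡C A<B)))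
        (trans (cong (hue (rep (part u)) ∘ rep) (sym (same {v} {w} B≡C))) (hue-parts u v A<B)))
      ... | inj₂ (A≡B , _) | inj₁ B<C = inj₂ (trans
        (sym (hue-parts u w (subst (ℕ._< Q.position (part w)) (sym A≡B) B<C)))
        (trans (cong (λ A → hue (rep A) (rep (part w))) (same {u} {v} A≡B)) (hue-parts v w B<C)))
      ... | inj₂ (A≡B , u<v′) | inj₂ (B≡C , v<w′) =
        inner-split (same {u} {v} A≡B) (same {v} {w} B≡C) (part-∋ u) (part-∋ v) (part-∋ w) u<v′ v<w′

    substitution : Layout hue (proj₁ {B = _∈ M})
    substitution = record
      { position  = position
      ; injective = λ {u} {v} eq → let A≡B , eq′ = lexicographic-≡ (inner<K u) (inner<K v) eq in
          inner-injective (same {u} {v} A≡B) (part-∋ u) (part-∋ v) eq′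
      ; split     = λ {u} {v} {w} → split {u} {v} {w}
      }

  -- Induction down the tree of strong modules: the parts of a strong module with at least two
  -- vertices are strong and strictly smaller.
  quotient-layouts⇒layout : (∀ M → IsStrongModule G M → Layout hue (rep {M})) →
                            ∀ M → IsStrongModule G M → Layout hue (proj₁ {B = _∈ M})
  quotient-layouts⇒layout Q M = go M (⊂-wellFounded M)
    where
    go : ∀ M → Acc _⊂_ M → IsStrongModule G M → Layout hue (proj₁ {B = _∈ M})
    go M (acc rec) sM@((x , x∈M) , _) with M ⊆? ⁅ x ⁆
    ... | yes M⊆x = record
      { position  = λ _ → 0
      ; injective = λ {(_ , u∈M)} {(_ , v∈M)} _ → trans (x∈⁅y⁆⇒x≡y x (M⊆x u∈M)) (sym (x∈⁅y⁆⇒x≡y x (M⊆x v∈M)))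
      ; split     = λ ()
      }
    ... | no M⊈x = substitution (Q M sM) λ A →
      go (value A) (rec (part-⊂ 2≤∣M∣ A)) (part-strong sM A)
      where
      2≤∣M∣ : 2 ℕ.≤ ∣ M ∣
      2≤∣M∣ = strong⊂⇒2≤ (singleton-strong x) (⊈singleton⇒⊂ x∈M M⊈x)

-- Components of a colour, without rainbow triangles

module Gallai (G : EdgeColoredGraph k (Fin n)) (noRainbow : ¬ HasRainbowTriangle G) where

  open Hue G
  open Decomposition G

  private
    variable
      i j l : Fin k
      X C D M : Subset n

  noRainbowAt : ∀ {a p q} → hue a p ≡ just i → hue a q ≡ just j → i ≢ j →
                hue p q ≡ just i ⊎ hue p q ≡ just j
  noRainbowAt {i} {j} {a} {p} {q} ap aq i≢j with hue p q ≟ʰ just i | hue p q ≟ʰ just j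
  ... | yes pq≡i | _        = inj₁ pq≡i
  ... | no _     | yes pq≡j = inj₂ pq≡j
  ... | no pq≢i  | no pq≢j  = contradiction
    (p , a , q , ≢-sym a≢p , a≢q , p≢q ,
      (λ eq → i≢j (trans (sym pa≡i) (trans eq aq≡j))) ,
      (λ eq → pq≢j (color⇒hue p≢q (trans (sym eq) aq≡j))) ,
      (λ eq → pq≢i (color⇒hue p≢q (trans (sym eq) pa≡i))))
    noRainbow
    where
    a≢p = hue⇒≢ ap
    a≢q = hue⇒≢ aq
    p≢q : p ≢ q
    p≢q refl = i≢j (just-injective (trans (sym ap) aq))
    pa≡i = hue⇒color (≢-sym a≢p) (trans (hue-sym p a) ap)
    aq≡j = hue⇒color a≢q aq

  -- Connectedness of the edges of colour i inside X, as an induction principle along such edges.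
  Connected : Fin k → Subset n → Set₁
  Connected i X = ∀ {P : Fin n → Set} → Decidable P →
    (∀ {u v} → u ∈ X → v ∈ X → hue u v ≡ just i → P u → P v) →
    ∀ {u v} → u ∈ X → v ∈ X → P u → P v

  -- These are the unions of components of colour `i` in `X`.
  Closed : Fin k → Subset n → Subset n → Set
  Closed i X C = C ⊆ X × (∀ u v → u ∈ C → v ∈ X → hue u v ≡ just i → v ∈ C)

  closed? : ∀ i X → Decidable (Closed i X)
  closed? i X C = (C ⊆? X) ×-dec all? λ u → all? λ v →
    (u ∈? C) →-dec ((v ∈? X) →-dec ((hue u v ≟ʰ just i) →-dec (v ∈? C)))

  -- Take a minimal closed set containing `x`. A property that holds at `x` and spreads along colour
  -- `i` cuts out a closed subset containing `x`, which by minimality is everything.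
  component : ∀ i {x} → x ∈ X → ∃[ C ] x ∈ C × Closed i X C × Connected i C
  component {X} i {x} x∈X
    with minimal (λ C → (x ∈? C) ×-dec closed? i X C) {X} (x∈X , (λ u∈ → u∈) , λ _ _ _ v∈X _ → v∈X)
  ... | C , (x∈C , closed@(C⊆X , close)) , min = C , x∈C , closed , connected
    where
    everywhere : ∀ {P : Fin n → Set} → Decidable P →
      (∀ {u v} → u ∈ C → v ∈ C → hue u v ≡ just i → P u → P v) → P x → ∀ {v} → v ∈ C → P v
    everywhere {P} P? step px v∈C = proj₂ (∈⟦⟧⁻ C∩P? (min ⟦ C∩P? ⟧
      ( ∈⟦⟧⁺ C∩P? (x∈C , px)
      , (λ u∈ → C⊆X (proj₁ (∈⟦⟧⁻ C∩P? u∈)))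
      , λ u v u∈ v∈X uv → let u∈C , pu = ∈⟦⟧⁻ C∩P? u∈ ; v∈C = close u v u∈C v∈X uv in
          ∈⟦⟧⁺ C∩P? (v∈C , step u∈C v∈C uv pu))
      (proj₁ ∘ ∈⟦⟧⁻ C∩P?) v∈C))
      where
      C∩P? : Decidable λ v → v ∈ C × P v
      C∩P? v = (v ∈? C) ×-dec P? v

    connected : Connected i C
    connected P? step {u} u∈C v∈C pu with P? x
    ... | yes px = everywhere P? step px v∈C
    -- Edges are symmetric, so the negation of `P` spreads as well; starting from `x` it would reach
    -- `u`.
    ... | no ¬px = contradiction pu (everywhere (¬? ∘ P?)
      (λ u∈C v∈C uv ¬pu pv → ¬pu (step v∈C u∈C (trans (hue-sym _ _) uv) pv)) ¬px u∈C)

  -- Without such an edge `P` would spread over all of `X`; a finite search turns this contradiction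
  -- into a witness.
  crossing : {P : Fin n → Set} → Connected i X → Decidable P → ∀ {u v} → u ∈ X → v ∈ X → P u → ¬ P v →
             ∃[ p ] ∃[ q ] p ∈ X × q ∈ X × P p × ¬ P q × hue p q ≡ just i
  crossing {i} {X} {P} conn P? u∈X v∈X pu ¬pv =
    decidable-stable
      (any? λ p → any? λ q →
        (p ∈? X) ×-dec ((q ∈? X) ×-dec (P? p ×-dec (¬? (P? q) ×-dec (hue p q ≟ʰ just i)))))
      λ none → ¬pv (conn P? (λ {p} {q} p∈X q∈X pq pp →
        decidable-stable (P? q) λ ¬pq → none (p , q , p∈X , q∈X , pp , ¬pq , pq)) u∈X v∈X pu)

  connected⊆closed : Closed i X C → Connected i D → D ⊆ X → ∀ {z} → z ∈ D → z ∈ C → D ⊆ C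
  connected⊆closed {C = C} (_ , close) connD D⊆X z∈D z∈C x∈D =
    connD (_∈? C) (λ u∈D v∈D uv u∈C → close _ _ u∈C (D⊆X v∈D) uv) z∈D x∈D z∈C

  -- If v sends different colours to the ends of an edge of colour i, then one of them is i.
  connected⇒uniform : Connected i C → ∀ {v} → v ∉ C → (∀ {u} → u ∈ C → hue v u ≢ just i) →
                      ∀ {u u′} → u ∈ C → u′ ∈ C → hue v u ≡ hue v u′
  connected⇒uniform {i} {C} connC {v} v∉C avoid {u} u∈C u′∈C =
    connC (λ t → hue v u ≟ʰ hue v t) step u∈C u′∈C refl
    where
    step : ∀ {t t′} → t ∈ C → t′ ∈ C → hue t t′ ≡ just i → hue v u ≡ hue v t → hue v u ≡ hue v t′
    step {t} {t′} t∈C t′∈C tt′ eq =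
      [ (λ vt′ → trans eq (trans vt (sym vt′)))
      , (λ vt′ → contradiction vt′ (avoid t′∈C)) ]′
      (noRainbowAt (trans (hue-sym t v) vt) tt′ (λ m≡i → avoid t∈C (trans vt (cong just m≡i))))
      where
      v≢t : v ≢ t
      v≢t refl = v∉C t∈C
      vt = hue-≢ v≢t

  closed⇒uniform : Closed i X C → Connected i C → ∀ {v} → v ∈ X → v ∉ C →
                   ∀ {u u′} → u ∈ C → u′ ∈ C → hue v u ≡ hue v u′
  closed⇒uniform (_ , close) connC v∈X v∉C = connected⇒uniform connC v∉C
    λ u∈C vu → v∉C (close _ _ u∈C v∈X (trans (hue-sym _ _) vu))

  ∈-delete : ∀ {a x} → x ∈ X - a → x ∈ X × x ≢ a
  ∈-delete {X} {a} x∈ = p─q⊆p X ⁅ a ⁆ x∈ , λ { refl → x∉p-x X a x∈ }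

  -- An edge of colour `i` must leave `D` inside `X`. As `D` is closed in `X - a`, it can only end
  -- at `a`.
  touches : Connected i X → ∀ {a} → a ∈ X → Closed i (X - a) D → ∀ {d} → d ∈ D → ∃[ w ] w ∈ D × hue a w ≡ just i
  touches {X = X} {D = D} connX {a} a∈X (D⊆ , close) d∈D
    with crossing connX (_∈? D) (proj₁ (∈-delete (D⊆ d∈D))) a∈X d∈D (λ a∈D → x∉p-x X a (D⊆ a∈D))
  ... | w , q , _ , q∈X , w∈D , q∉D , wq with q ≟ a
  ...   | yes refl = w , w∈D , trans (hue-sym a w) wq
  ...   | no q≢a   = contradiction (close w q w∈D (x∈p∧x≢y⇒x∈p-y q∈X q≢a) wq) q∉D

  -- Two components of colour i in X - a would both be joined to a by colour i, which
  -- forces the colour between them to be both j and l.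
  connected-delete : i ≢ j → i ≢ l → j ≢ l → Connected i X →
                     ∀ {a y z} → a ∈ X → y ∈ X → z ∈ X → hue a y ≡ just j → hue a z ≡ just l →
                     Connected i (X - a)
  connected-delete {i} {j} {l} {X} i≢j i≢l j≢l connX {a} {y} {z} a∈X y∈X z∈X ay az
    with component i (x∈p∧x≢y⇒x∈p-y y∈X (≢-sym (hue⇒≢ ay)))
  ... | C , y∈C , closedC@(C⊆ , closeC) , connC with (X - a) ⊆? C
  ...   | yes ⊆C = subst (Connected i) (⊆-antisym C⊆ ⊆C) connC
  ...   | no ⊈C  = ⊥-elim (z∉C⇒⊥ z∈C⇒⊥)
    where
    z∈X-a : z ∈ X - a
    z∈X-a = x∈p∧x≢y⇒x∈p-y z∈X (≢-sym (hue⇒≢ az))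

    opposite : ∀ {u t m} → hue a u ≡ just i → hue a t ≡ just m → i ≢ m → hue u t ≢ just i → hue u t ≡ just m
    opposite au at i≢m ut≢i = [ (λ ut → contradiction ut ut≢i) , id ]′ (noRainbowAt au at i≢m)

    outside-edge : ∀ {u t} → u ∈ X - a → u ∉ C → t ∈ C → hue u t ≢ just i
    outside-edge u∈ u∉C t∈C ut = u∉C (closeC _ _ t∈C u∈ (trans (hue-sym _ _) ut))

    -- With y and z both in `C`, a second component has a vertex u joined to a by colour `i`. The
    -- triangles at a give uy colour `j` and uz colour `l`, although u sees `C` uniformly.
    z∈C⇒⊥ : z ∉ C
    z∈C⇒⊥ z∈C with ⊈⇒∃∉ ⊈C
    ... | v , v∈ , v∉C with component i v∈
    ...   | D , v∈D , closedD@(D⊆ , _) , connD with touches connX a∈X closedD v∈D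
    ...     | u , u∈D , au = j≢l (just-injective (trans (sym uy) (trans
                (closed⇒uniform closedC connC (D⊆ u∈D) u∉C y∈C z∈C) uz)))
      where
      u∉C : u ∉ C
      u∉C u∈C = v∉C (connected⊆closed closedC connD D⊆ u∈D u∈C v∈D)
      uy : hue u y ≡ just j
      uy = opposite au ay i≢j (outside-edge (D⊆ u∈D) u∉C y∈C)
      uz : hue u z ≡ just l
      uz = opposite au az i≢l (outside-edge (D⊆ u∈D) u∉C z∈C)

    -- With z in another component `D`, choose u in `D` and w in `C`, both joined to a by colour
    -- `i`. Then uw has the colour of uy, which is `j`, and also that of wz, which is `l`.
    z∉C⇒⊥ : ¬ z ∉ C
    z∉C⇒⊥ z∉C with component i z∈X-a
    ... | D , z∈D , closedD@(D⊆ , _) , connD with touches connX a∈X closedD z∈D | touches connX a∈X closedC y∈C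
    ...   | u , u∈D , au | w , w∈C , aw = j≢l (just-injective (trans (sym wu) (trans
              (closed⇒uniform closedD connD (C⊆ w∈C) w∉D u∈D z∈D) wz)))
      where
      D∩C : ∀ {x} → x ∈ D → x ∉ C
      D∩C x∈D x∈C = z∉C (connected⊆closed closedC connD D⊆ x∈D x∈C z∈D)
      w∉D : w ∉ D
      w∉D w∈D = D∩C w∈D w∈C
      wz : hue w z ≡ just l
      wz = opposite aw az i≢l λ eq → outside-edge z∈X-a z∉C w∈C (trans (hue-sym z w) eq)
      wu : hue w u ≡ just j
      wu = trans (hue-sym w u) (trans
        (closed⇒uniform closedC connC (D⊆ u∈D) (D∩C u∈D) w∈C y∈C)
        (opposite au ay i≢j (outside-edge (D⊆ u∈D) (D∩C u∈D) y∈C)))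

  neighbour : Connected i X → ∀ {u v} → u ∈ X → v ∈ X → u ≢ v → ∃[ w ] w ∈ X × hue u w ≡ just i
  neighbour connX {u} u∈X v∈X u≢v with crossing connX (_≟ u) u∈X v∈X refl (≢-sym u≢v)
  ... | _ , w , _ , w∈X , refl , _ , uw = w , w∈X , uw

  -- Deleting a vertex keeps the three colours connected, so there is no smallest such X.
  ¬three-connected-colors : i ≢ j → i ≢ l → j ≢ l → ∀ X → Connected i X → Connected j X → Connected l X →
                            ∀ {u v} → u ∈ X → v ∈ X → u ≡ v
  ¬three-connected-colors {i} {j} {l} i≢j i≢l j≢l X ci cj cl {u} {v} u∈X v∈X =
    decidable-stable (u ≟ v) (go X (⊂-wellFounded X) ci cj cl u∈X v∈X)
    where
    go : ∀ X → Acc _⊂_ X → Connected i X → Connected j X → Connected l X → ∀ {u v} → u ∈ X → v ∈ X → ¬ u ≢ v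
    go X (acc rec) ci cj cl {u} u∈X v∈X u≢v
      with neighbour ci u∈X v∈X u≢v | neighbour cj u∈X v∈X u≢v | neighbour cl u∈X v∈X u≢v
    -- For each colour, the neighbours of u in the other two colours justify the deletion. The
    -- vertices y and z survive it and differ, since u sends them different colours.
    ... | x , x∈X , ux | y , y∈X , uy | z , z∈X , uz = go (X - u) (rec (x∈p⇒p-x⊂p u∈X))
      (connected-delete i≢j i≢l j≢l ci u∈X y∈X z∈X uy uz)
      (connected-delete (≢-sym i≢j) j≢l i≢l cj u∈X x∈X z∈X ux uz)
      (connected-delete (≢-sym i≢l) (≢-sym j≢l) i≢j cl u∈X x∈X y∈X ux uy)
      (x∈p∧x≢y⇒x∈p-y y∈X (≢-sym (hue⇒≢ uy)))
      (x∈p∧x≢y⇒x∈p-y z∈X (≢-sym (hue⇒≢ uz)))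
      λ { refl → j≢l (just-injective (trans (sym uy) uz)) }

  -- Vertices outside `M` see `C` uniformly because `M` is a module, and vertices of `M` outside `C`
  -- do so because no rainbow triangle exists. Strength of `M` leaves only modules inside `M` to be
  -- compared with `C`.
  component-strong : IsStrongModule G M → Closed i M C → Connected i C → Nonempty C → IsStrongModule G C
  component-strong {M} {i} {C} (_ , modM , tri) closed@(C⊆M , close) connC ne =
    ne , hue⇒module uniform , compare
    where
    uniform : ∀ v → v ∉ C → ∀ u u′ → u ∈ C → u′ ∈ C → hue u v ≡ hue u′ v
    uniform v v∉C u u′ u∈C u′∈C with v ∈? M
    ... | no v∉M  = module⇒hue modM v∉M (C⊆M u∈C) (C⊆M u′∈C)
    ... | yes v∈M = trans (hue-sym u v) (trans (closed⇒uniform closed connC v∈M v∉C u∈C u′∈C) (hue-sym v u′))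

    -- Let v ∈ M′ \ C, and let t t′ be an edge of colour i in C with t ∈ M′ and t′ ∉ M′.
    -- Then v t′ has colour i as well, so v ∈ C.
    compare : ∀ M′ → IsModule G M′ → C ⊆ M′ ⊎ M′ ⊆ C ⊎ Empty (C ∩ M′)
    compare M′ mod′ with tri M′ mod′
    ... | inj₁ M⊆M′         = inj₁ λ x∈C → M⊆M′ (C⊆M x∈C)
    ... | inj₂ (inj₂ empty) = inj₂ (inj₂ λ (x , x∈) → let x∈C , x∈M′ = x∈p∩q⁻ C M′ x∈ in
                                empty (x , x∈p∩q⁺ (C⊆M x∈C , x∈M′)))
    ... | inj₂ (inj₁ M′⊆M) with M′ ⊆? C | nonempty? (C ∩ M′)
    ...   | yes M′⊆C | _        = inj₂ (inj₁ M′⊆C)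
    ...   | no _     | no empty = inj₂ (inj₂ empty)
    ...   | no M′⊈C  | yes (x , x∈) with ⊈⇒∃∉ M′⊈C | x∈p∩q⁻ C M′ x∈
    ...     | v , v∈M′ , v∉C | x∈C , x∈M′ = inj₁ λ y∈C →
      connC (_∈? M′) (λ {t} {t′} t∈C t′∈C tt′ t∈M′ → decidable-stable (t′ ∈? M′) λ t′∉M′ →
        v∉C (close t′ v t′∈C (M′⊆M v∈M′)
          (trans (hue-sym t′ v) (trans (module⇒hue mod′ t′∉M′ v∈M′ t∈M′) tt′))))
        x∈C y∈C x∈M′

  -- The component of colour `i` through `rep A` also contains `rep B`. If it were not all of `M`,
  -- it would be a strong module properly inside `M` and hence lie in a single part.
  quotient-connected : IsStrongModule G M → (A B : QuotientVertex G M) → hue (rep A) (rep B) ≡ just i → Connected i M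
  quotient-connected {M} {i} sM A B ab with component i (part-⊆ A (rep-∈ A))
  ... | C , a∈C , closed@(C⊆M , close) , connC with M ⊆? C
  ...   | yes M⊆C = subst (Connected i) (⊆-antisym C⊆M M⊆C) connC
  ...   | no M⊈C  = contradiction (cong rep A≡B) (hue⇒≢ ab)
    where
    over = part-over (component-strong sM closed connC (_ , a∈C)) (C⊆M , ⊈⇒∃∉ M⊈C)
    b∈C = close _ _ a∈C (part-⊆ B (rep-∈ B)) ab
    A≡B : A ≡ B
    A≡B = trans (same-part A (proj₁ over) (rep-∈ A) (proj₂ over a∈C))
      (sym (same-part B (proj₁ over) (rep-∈ B) (proj₂ over b∈C)))

  quotient-two-colors : IsStrongModule G M → (A B C D E F : QuotientVertex G M) →
                        hue (rep A) (rep B) ≡ just i → hue (rep C) (rep D) ≡ just j → i ≢ j →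
                        hue (rep E) (rep F) ≡ just l → l ≡ i ⊎ l ≡ j
  quotient-two-colors {M} {i} {j} {l} sM A B C D E F ab cd i≢j ef with l ≟ i | l ≟ j
  ... | yes l≡i | _       = inj₁ l≡i
  ... | no _    | yes l≡j = inj₂ l≡j
  ... | no l≢i  | no l≢j  = contradiction
    (¬three-connected-colors i≢j (≢-sym l≢i) (≢-sym l≢j) M
      (quotient-connected sM A B ab) (quotient-connected sM C D cd) (quotient-connected sM E F ef)
      (part-⊆ A (rep-∈ A)) (part-⊆ B (rep-∈ B)))
    (hue⇒≢ ab)

-- Layouts from few colours, and the colours of quotients

module _ (G : EdgeColoredGraph k (Fin n)) where

  open Hue G
  open Decomposition G

  -- Splitting gives two edges of any triangle the same colour. Being rainbow survives renaming the
  -- vertices, so they may be sorted by position first.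
  layout⇒¬rainbow : Layout hue id → ¬ HasRainbowTriangle G
  layout⇒¬rainbow L (u , v , w , u≢v , v≢w , u≢w , uv≢vw , vw≢uw , uv≢uw) =
    ¬rainbow (hue-distinct u≢v v≢w uv≢vw , hue-distinct v≢w u≢w vw≢uw , hue-distinct u≢v u≢w uv≢uw)
    where
    open Layout L

    hue-distinct : ∀ {a b c d} (a≢b : a ≢ b) (c≢d : c ≢ d) → color G a b a≢b ≢ color G c d c≢d → hue a b ≢ hue c d
    hue-distinct a≢b c≢d ne eq = ne (hue⇒color a≢b (trans eq (hue-≢ c≢d)))

    Rainbow : Fin n → Fin n → Fin n → Set
    Rainbow a b c = hue a b ≢ hue b c × hue b c ≢ hue a c × hue a b ≢ hue a c

    swap₁₂ : ∀ {a b c} → Rainbow a b c → Rainbow b a c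
    swap₁₂ {a} {b} (p , q , r) rewrite hue-sym a b = r , ≢-sym q , p

    swap₂₃ : ∀ {a b c} → Rainbow a b c → Rainbow a c b
    swap₂₃ {b = b} {c} (p , q , r) rewrite hue-sym b c = ≢-sym q , ≢-sym p , ≢-sym r

    sorted : ∀ {a b c} → position a ℕ.< position b → position b ℕ.< position c → ¬ Rainbow a b c
    sorted a<b b<c (_ , bc≢ac , ab≢ac) = [ ≢-sym ab≢ac , ≢-sym bc≢ac ]′ (split a<b b<c)

    ordered : ∀ {a b} → a ≢ b → position a ℕ.< position b ⊎ position b ℕ.< position a
    ordered {a} {b} a≢b with ℕ.<-cmp (position a) (position b)
    ... | tri< lt _ _ = inj₁ lt
    ... | tri≈ _ eq _ = contradiction (injective eq) a≢b
    ... | tri> _ _ gt = inj₂ gt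

    ¬rainbow : ¬ Rainbow u v w
    ¬rainbow r with ordered u≢v | ordered v≢w | ordered u≢w
    ... | inj₁ u<v | inj₁ v<w | _        = sorted u<v v<w r
    ... | inj₁ u<v | inj₂ w<v | inj₁ u<w = sorted u<w w<v (swap₂₃ r)
    ... | inj₁ u<v | inj₂ w<v | inj₂ w<u = sorted w<u u<v (swap₁₂ (swap₂₃ r))
    ... | inj₂ v<u | inj₁ v<w | inj₁ u<w = sorted v<u u<w (swap₁₂ r)
    ... | inj₂ v<u | inj₁ v<w | inj₂ w<u = sorted v<w w<u (swap₂₃ (swap₁₂ r))
    ... | inj₂ v<u | inj₂ w<v | _        = sorted w<v v<u (swap₁₂ (swap₂₃ (swap₁₂ r)))

  uniform⇒layout : {e : V → Fin n} {o : Maybe (Fin k)} → V ↔ Fin m →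
                   (∀ u v → u ≢ v → hue (e u) (e v) ≡ o) → Layout hue e
  uniform⇒layout {e = e} ι uniform = record
    { position  = toℕ ∘ to
    ; injective = λ {u} {v} eq → cong e (decidable-stable (finite-≟ ι u v) λ u≢v →
        u≢v (trans (sym (strictlyInverseʳ u)) (trans (cong from (Fin.toℕ-injective eq)) (strictlyInverseʳ v))))
    ; split     = λ {u} {v} {w} u<v v<w → inj₁
        (trans (uniform u w (distinct (ℕ.<-trans u<v v<w))) (sym (uniform u v (distinct u<v))))
    }
    where
    open Inverse ι
    distinct : ∀ {u v} → to u Fin.< to v → u ≢ v
    distinct lt eq = ℕ.<⇒≢ lt (cong (toℕ ∘ to) eq)

  -- The labels for colour `i` serve for both colours: edges of colour `i` split as inversions, and
  -- edges of colour `j` split because inversions compose.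
  two-colors⇒layout : {e : V → Fin n} {i j : Fin k} → IsPermutationGraph (monochromatic G i) →
                      (∀ u v → e u ≢ e v → hue (e u) (e v) ≡ just i ⊎ hue (e u) (e v) ≡ just j) → Layout hue e
  two-colors⇒layout {V} {e} {i} {j} (m , ℓ , π , permGraph) two = record
    { position  = toℕ ∘ to ∘ e
    ; injective = λ {u} {v} eq →
        trans (sym (strictlyInverseʳ (e u))) (trans (cong from (Fin.toℕ-injective eq)) (strictlyInverseʳ (e v)))
    ; split     = split
    }
    where
    open Inverse ℓ
    distinct : ∀ {x y} → to x Fin.< to y → x ≢ y
    distinct lt eq = ℕ.<⇒≢ lt (cong (toℕ ∘ to) eq)

    split : ∀ {u v w} → to (e u) Fin.< to (e v) → to (e v) Fin.< to (e w) →
            hue (e u) (e w) ≡ hue (e u) (e v) ⊎ hue (e u) (e w) ≡ hue (e v) (e w)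
    split {u} {v} {w} u<v v<w
      with two u w (distinct (ℕ.<-trans u<v v<w)) | two u v (distinct u<v) | two v w (distinct v<w)
    ... | inj₂ uw≡j | inj₂ uv≡j | _         = inj₁ (trans uw≡j (sym uv≡j))
    ... | inj₂ uw≡j | inj₁ _    | inj₂ vw≡j = inj₂ (trans uw≡j (sym vw≡j))
    -- Two consecutive inversions make uw an inversion too, so uw has colour `i`, like uv.
    ... | inj₂ uw≡j | inj₁ uv≡i | inj₁ vw≡i =
      let u≢w , eq = permutationGraph-trans {H = monochromatic G i} {ℓ} {π} permGraph u<v v<w
                       (distinct u<v , hue⇒color (distinct u<v) uv≡i) (distinct v<w , hue⇒color (distinct v<w) vw≡i)
      in inj₁ (trans (color⇒hue u≢w eq) (sym uv≡i))
    ... | inj₁ uw≡i | _ | _ =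
      let u<w = ℕ.<-trans u<v v<w in
      [ (λ (u≢v , eq) → inj₁ (trans uw≡i (sym (color⇒hue u≢v eq))))
      , (λ (v≢w , eq) → inj₂ (trans uw≡i (sym (color⇒hue v≢w eq)))) ]′
      (permutationGraph-split {H = monochromatic G i} {ℓ} {π} permGraph u<v v<w
        (distinct u<w , hue⇒color (distinct u<w) uw≡i))

  -- The common value lies in `Maybe (Fin k)`, so a one-vertex quotient is included even when there
  -- are no colours.
  UniformQuotient : Subset n → Set
  UniformQuotient M = ∃[ o ] (∀ (A B : QuotientVertex G M) → A ≢ B → hue (rep A) (rep B) ≡ o)

  TwoColoredEdges : Subset n → Set
  TwoColoredEdges M = ∃[ A ] ∃[ B ] ∃[ C ] ∃[ D ]
    Σ[ A≢B ∈ A ≢ B ] Σ[ C≢D ∈ C ≢ D ] color (quotient G M) A B A≢B ≢ color (quotient G M) C D C≢D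

  -- Primeness is only a negation; the finite search replaces it by explicit edges of different
  -- colours.
  quotient-cases : ∀ M → UniformQuotient M ⊎ TwoColoredEdges M
  quotient-cases M with quotient-finite M
  ... | m , ι with finite-any? ι (λ A → finite-any? ι λ B → ¬? (finite-≟ ι A B))
  ...   | no none = inj₁ (nothing , λ A B A≢B → contradiction (A , B , A≢B) none)
  ...   | yes (A , B , A≢B) with finite-any? ι (λ C → finite-any? ι λ D →
            ¬? (finite-≟ ι C D) ×-dec ¬? (hue (rep A) (rep B) ≟ʰ hue (rep C) (rep D)))
  ...     | no none = inj₁ (hue (rep A) (rep B) , λ C D C≢D → sym
            (decidable-stable (_ ≟ʰ _) λ ne → none (C , D , C≢D , ne)))
  ...     | yes (C , D , C≢D , ne) = inj₂ (A , B , C , D , A≢B , C≢D , λ eq →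
            ne (trans (quotient-agree A B A≢B) (trans (cong just eq) (sym (quotient-agree C D C≢D)))))

  quotient-layout⇒permutationGraph : ∀ M → Layout hue (rep {M}) → IsEdgeColoredPermutationGraph (quotient G M)
  quotient-layout⇒permutationGraph M =
    layout⇒permutationGraph (quotient G M) rep quotient-agree (proj₂ (quotient-finite M))

  uniform-quotient⇒permutationGraph : ∀ M → UniformQuotient M → IsEdgeColoredPermutationGraph (quotient G M)
  uniform-quotient⇒permutationGraph M (_ , uniform) =
    quotient-layout⇒permutationGraph M (uniform⇒layout (proj₂ (quotient-finite M)) uniform)

  two-colored⇒prime : ∀ {M} → TwoColoredEdges M → IsPrime G M
  two-colored⇒prime (A , B , C , D , A≢B , C≢D , ne) (_ , same) = ne (same A B C D A≢B C≢D)

  distinct-parts : ∀ {M} → IsStrongModule G M → 2 ℕ.≤ ∣ M ∣ →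
                   Σ[ A ∈ QuotientVertex G M ] Σ[ B ∈ QuotientVertex G M ] A ≢ B
  distinct-parts ((x , x∈M) , _) 2≤∣M∣ with part-of x∈M
  ... | A , x∈A with part-⊂ 2≤∣M∣ A
  ...   | _ , y , y∈M , y∉A with part-of y∈M
  ...     | B , y∈B = A , B , λ { refl → y∉A y∈B }

  -- A strong module with at least two vertices has two distinct parts, so a uniform quotient would
  -- make it series.
  uniform-prime⇒small : ∀ {M} → IsStrongModule G M → IsPrime G M → UniformQuotient M → ¬ 2 ℕ.≤ ∣ M ∣
  uniform-prime⇒small {M} sM prime (o , uniform) 2≤∣M∣ = prime (distinct-parts sM 2≤∣M∣ , λ A B C D A≢B C≢D →
    just-injective (trans (sym (quotient-agree A B A≢B)) (trans (trans (uniform A B A≢B) (sym (uniform C D C≢D)))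
      (quotient-agree C D C≢D))))

  module _ (noRainbow : ¬ HasRainbowTriangle G) where

    open Gallai G noRainbow

    two-colored-quotient : ∀ {M} → IsStrongModule G M → TwoColoredEdges M → Is2EdgeColored (quotient G M)
    two-colored-quotient {M} sM (A , B , C , D , A≢B , C≢D , ne) =
      _ , _ , ne , (A , B , A≢B , refl) , (C , D , C≢D , refl) , λ E F E≢F →
        quotient-two-colors sM A B C D E F (quotient-agree A B A≢B) (quotient-agree C D C≢D) ne (quotient-agree E F E≢F)

  two-colored-quotient⇒layout : ∀ {M} → (∀ i → IsPermutationGraph (monochromatic G i)) →
                                Is2EdgeColored (quotient G M) → Layout hue (rep {M})
  two-colored-quotient⇒layout perm (i , j , _ , _ , _ , two) = two-colors⇒layout (perm i) λ A B ne →
    let A≢B = λ A≡B → ne (cong rep A≡B) in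
    [ (λ eq → inj₁ (trans (quotient-agree A B A≢B) (cong just eq)))
    , (λ eq → inj₂ (trans (quotient-agree A B A≢B) (cong just eq))) ]′ (two A B A≢B)

-- Equivalence of the five conditions

theorem4p1 : ∀ (k n : ℕ) (G : EdgeColoredGraph k (Fin n)) → IsCompleteEdgeColored G →
    let cond-i = IsEdgeColoredPermutationGraph G
        cond-ii = ∀ (W : Subset n) → IsEdgeColoredPermutationGraph (induced G W)
        cond-iii = ∀ (M : Subset n) → IsStrongModule G M →
                     IsEdgeColoredPermutationGraph (quotient G M)
        cond-iv = ∀ (M : Subset n) → IsStrongModule G M → IsPrime G M →
                    IsEdgeColoredPermutationGraph (quotient G M)
                    × (3 ≤ ∣ M ∣ → Is2EdgeColored (quotient G M))
        cond-v = (∀ i → IsPermutationGraph (monochromatic G i))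
                 × ¬ HasRainbowTriangle G
    in (cond-i ⇔ cond-ii) × (cond-i ⇔ cond-iii) × (cond-i ⇔ cond-iv) × (cond-i ⇔ cond-v)
theorem4p1 k n G _ =
  -- Apart from this pair, all implications come from the cycle (i), (v), (iv), (iii), (i).
  mk⇔ i⇒ii ii⇒i ,
  mk⇔ (iv⇒iii ∘ v⇒iv ∘ i⇒v) iii⇒i ,
  mk⇔ (v⇒iv ∘ i⇒v) (iii⇒i ∘ iv⇒iii) ,
  mk⇔ i⇒v (iii⇒i ∘ iv⇒iii ∘ v⇒iv)
  where
  open Hue G
  open Decomposition G

  cond-i = IsEdgeColoredPermutationGraph G
  cond-ii = ∀ (W : Subset n) → IsEdgeColoredPermutationGraph (induced G W)
  cond-iii = ∀ (M : Subset n) → IsStrongModule G M → IsEdgeColoredPermutationGraph (quotient G M)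
  cond-iv = ∀ (M : Subset n) → IsStrongModule G M → IsPrime G M →
    IsEdgeColoredPermutationGraph (quotient G M) × (3 ≤ ∣ M ∣ → Is2EdgeColored (quotient G M))
  cond-v = (∀ i → IsPermutationGraph (monochromatic G i)) × ¬ HasRainbowTriangle G

  i⇒layout : cond-i → Layout hue id
  i⇒layout = permutationGraph⇒layout G id (λ _ _ → hue-≢)

  layout⇒i : Layout hue id → cond-i
  layout⇒i = layout⇒permutationGraph G id (λ _ _ → hue-≢) ↔-refl

  induced-agree : ∀ W u v (u≢v : u ≢ v) → hue (value u) (value v) ≡ just (color (induced G W) u v u≢v)
  induced-agree W u v u≢v = hue-≢ (u≢v ∘ value-injective)

  i⇒ii : cond-i → cond-ii
  i⇒ii perm W = layout⇒permutationGraph (induced G W) value (induced-agree W) (proj₂ finite)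
    (pullback (i⇒layout perm) value)
    where
    finite : ∃[ m ] (Refinement (Fin n) (_∈ W) ↔ Fin m)
    finite = embedding⇒finite value value-injective λ x → map′ (λ x∈W → (x , [ x∈W ]) , refl)
      (λ { ((_ , [ x∈W ]) , refl) → recompute (x ∈? W) x∈W }) (x ∈? W)

  ii⇒i : cond-ii → cond-i
  ii⇒i perm = layout⇒i (pullback
    (permutationGraph⇒layout (induced G ⊤) value (induced-agree ⊤) (perm ⊤)) (λ x → x , [ ∈⊤ ]))

  i⇒v : cond-i → cond-v
  i⇒v perm@(m , ℓ , π , permGraph) = (λ i → m , ℓ , π i , permGraph i) , layout⇒¬rainbow G (i⇒layout perm)

  v⇒iv : cond-v → cond-iv
  v⇒iv (perm , noRainbow) M sM prime =
    [ (λ uniform → uniform-quotient⇒permutationGraph G M uniform ,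
        λ 3≤∣M∣ → contradiction (ℕ.<⇒≤ 3≤∣M∣) (uniform-prime⇒small G sM prime uniform))
    , (λ two → let two-colored = two-colored-quotient G noRainbow sM two in
        quotient-layout⇒permutationGraph G M (two-colored-quotient⇒layout G perm two-colored) , λ _ → two-colored)
    ]′ (quotient-cases G M)

  -- Uniform quotients are permutation graphs in any order; all other quotients belong to prime
  -- modules, where (iv) applies.
  iv⇒iii : cond-iv → cond-iii
  iv⇒iii h M sM =
    [ uniform-quotient⇒permutationGraph G M
    , (λ two → proj₁ (h M sM (two-colored⇒prime G two)))
    ]′ (quotient-cases G M)

  iii⇒i : cond-iii → cond-i
  iii⇒i h with nonempty? (⊤ {n})
  -- Strong modules are nonempty, so a graph without vertices has none to start from and is laid out
  -- directly.
  ... | no empty = layout⇒i (record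
    { position = λ _ → 0 ; injective = λ {u} _ → contradiction (u , ∈⊤) empty ; split = λ () })
  ... | yes ne = layout⇒i (pullback (quotient-layouts⇒layout
    (λ M sM → permutationGraph⇒layout (quotient G M) rep quotient-agree (h M sM)) ⊤ strong-⊤) (λ x → x , ∈⊤))
    where
    strong-⊤ : IsStrongModule G ⊤
    strong-⊤ = ne , (λ v v∉⊤ → contradiction ∈⊤ v∉⊤) , λ M′ _ → inj₂ (inj₁ (⊆-max M′))
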